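{- The scheme $\sim(\sim\sim\alpha\vee\beta)\rightarrow_{d}\sim(\alpha\vee\beta)$ is not provable in the axiom system $\mathrm{C}$; that is, there are formulas $\alpha,\beta$ such that $\sim(\sim\sim\alpha\vee\beta)\rightarrow_{d}\sim(\alpha\vee\beta)$ is not a theorem of $\mathrm{C}$.
   Context: Formulas are built from a countably infinite set of propositional variables using the unary connective $\sim$ (negation) and the binary connectives $\vee$ (disjunction), $\rightarrow_{d}$ (discussive implication), $\wedge_{d}$ (discussive conjunction), all treated as primitive. $\sim$ binds more tightly than the binary connectives. The axiom system $\mathrm{C}$ has as its sole rule modus ponens for $\rightarrow_{d}$ (from $\alpha$ and $\alpha\rightarrow_{d}\beta$ infer $\beta$), and as axioms all instances (for arbitrary formulas $\alpha,\beta,\gamma$) of the following schemes: C1: $\alpha\rightarrow_{d}(\beta\rightarrow_{d}\alpha)$. C2: $(\alpha\rightarrow_{d}(\beta\rightarrow_{d}\gamma))\rightarrow_{d}((\alpha\rightarrow_{d}\beta)\rightarrow_{d}(\alpha\rightarrow_{d}\gamma))$. C3: $(\alpha\wedge_{d}\beta)\rightarrow_{d}\alpha$. C4: $(\alpha\wedge_{d}\beta)\rightarrow_{d}\beta$. C5: $\alpha\rightarrow_{d}(\beta\rightarrow_{d}(\alpha\wedge_{d}\beta))$. C6: $\alpha\rightarrow_{d}(\alpha\vee\beta)$. C7: $\beta\rightarrow_{d}(\alpha\vee\beta)$. C8: $(\alpha\rightarrow_{d}\gamma)\rightarrow_{d}((\beta\rightarrow_{d}\gamma)\rightarrow_{d}((\alpha\vee\beta)\rightarrow_{d}\gamma))$.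 C9: $\alpha\vee(\alpha\rightarrow_{d}\beta)$. C10: $\sim(\sim\alpha\wedge_{d}(\sim\sim\alpha\wedge_{d}\sim(\alpha\vee\sim\alpha)))$. C11: $\sim(\sim\alpha\wedge_{d}(\sim\beta\wedge_{d}\sim(\alpha\vee\beta)))\rightarrow_{d}\sim(\sim\alpha\wedge_{d}(\sim\beta\wedge_{d}(\sim\gamma\wedge_{d}\sim(\alpha\vee(\beta\vee\gamma)))))$. C12: $\sim(\sim\alpha\wedge_{d}(\sim\beta\wedge_{d}(\sim\gamma\wedge_{d}\sim(\alpha\vee(\beta\vee\gamma)))))\rightarrow_{d}\sim(\sim\alpha\wedge_{d}(\sim\gamma\wedge_{d}(\sim\beta\wedge_{d}\sim(\alpha\vee(\gamma\vee\beta)))))$. C13: $\sim(\sim\alpha\wedge_{d}(\sim\beta\wedge_{d}(\sim\gamma\wedge_{d}\sim(\alpha\vee(\beta\vee\gamma)))))\rightarrow_{d}((\alpha\vee(\beta\vee\sim\gamma))\rightarrow_{d}(\alpha\vee\beta))$. C14: $\sim(\sim\alpha\wedge_{d}\sim\beta)\rightarrow_{d}(\alpha\vee\beta)$. C15: $(\alpha\vee(\beta\vee\sim\beta))\rightarrow_{d}\sim(\sim\alpha\wedge_{d}\sim(\beta\vee\sim\beta))$. A theorem of $\mathrm{C}$ is a formula derivable from these axioms by finitely many applications of modus ponens. A scheme is said to be unprovable in $\mathrm{C}$ if at least one of its instances is not a theorem of $\mathrm{C}$. -}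

module Defs where

open import Data.Nat using (ℕ)

infix  9 ∼_
infixr 7 _∧d_
infixr 6 _∨_
infixr 5 _→d_
infix  3 ⊢_

data Formula : Set where
  var  : ℕ → Formula
  ∼_   : Formula → Formula
  _∨_  : Formula → Formula → Formula
  _→d_ : Formula → Formula → Formula
  _∧d_ : Formula → Formula → Formula

data Axiom : Formula → Set where
  C1  : ∀ α β → Axiom (α →d (β →d α))
  C2  : ∀ α β γ → Axiom ((α →d (β →d γ)) →d ((α →d β) →d (α →d γ)))
  C3  : ∀ α β → Axiom ((α ∧d β) →d α)
  C4  : ∀ α β → Axiom ((α ∧d β) →d β)
  C5  : ∀ α β → Axiom (α →d (β →d (α ∧d β)))
  C6  : ∀ α β → Axiom (α →d (α ∨ β))
  C7  : ∀ α β → Axiom (β →d (α ∨ β))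
  C8  : ∀ α β γ → Axiom ((α →d γ) →d ((β →d γ) →d ((α ∨ β) →d γ)))
  C9  : ∀ α β → Axiom (α ∨ (α →d β))
  C10 : ∀ α → Axiom (∼ (∼ α ∧d (∼ ∼ α ∧d ∼ (α ∨ ∼ α))))
  C11 : ∀ α β γ → Axiom
    (∼ (∼ α ∧d (∼ β ∧d ∼ (α ∨ β)))
      →d ∼ (∼ α ∧d (∼ β ∧d (∼ γ ∧d ∼ (α ∨ (β ∨ γ))))))
  C12 : ∀ α β γ → Axiom
    (∼ (∼ α ∧d (∼ β ∧d (∼ γ ∧d ∼ (α ∨ (β ∨ γ)))))
      →d ∼ (∼ α ∧d (∼ γ ∧d (∼ β ∧d ∼ (α ∨ (γ ∨ β))))))
  C13 : ∀ α β γ → Axiom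
    (∼ (∼ α ∧d (∼ β ∧d (∼ γ ∧d ∼ (α ∨ (β ∨ γ)))))
      →d ((α ∨ (β ∨ ∼ γ)) →d (α ∨ β)))
  C14 : ∀ α β → Axiom (∼ (∼ α ∧d ∼ β) →d (α ∨ β))
  C15 : ∀ α β → Axiom ((α ∨ (β ∨ ∼ β)) →d ∼ (∼ α ∧d ∼ (β ∨ ∼ β)))

data ⊢_ : Formula → Set where
  ax : ∀ {α} → Axiom α → ⊢ α
  mp : ∀ {α β} → ⊢ α → ⊢ α →d β → ⊢ β

{-# OPTIONS --safe #-}
-- A four-valued matrix validates C and refutes the scheme.  Its values form the
-- chain 0 < 1 < 2 < 3, all but 0 are designated, and ∨ is the maximum.  The
-- connectives →d and ∧d act classically on designation, and negation is
-- 0 ↦ 1, 1 ↦ 0, 2 ↦ 3, 3 ↦ 0, so that ∼ x is designated exactly for x ∈ {0 , 2}.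
-- This set is closed under maxima, which is what C11, C12 and C13 need, and
-- x ∨ ∼ x always lies outside it, which gives C15.  Double negation lowers 3 to 1,
-- that is, below 2: for α = 3 and β = 2 we get ∼ ∼ α ∨ β = 2 but α ∨ β = 3.
module Submission where

open import Defs
open import Data.Bool using (Bool; true; false; if_then_else_; not; _∧_)
  renaming (_∨_ to _or_)
open import Data.Bool.Properties using () renaming (_≟_ to _≟ᵇ_)
open import Data.Fin using (Fin; _≤?_)
open import Data.Fin.Patterns using (0F; 1F; 2F; 3F)
open import Data.Fin.Properties using (all?)
open import Data.Nat using (ℕ; zero; suc)
open import Data.Product using (∃₂; _,_)
open import Relation.Binary.PropositionalEquality using (_≡_)
open import Relation.Nullary using (¬_; Dec; does; contradiction)
open import Relation.Nullary.Decidable using (True; toWitness; _→-dec_)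

Value : Set
Value = Fin 4

designated : Value → Bool
designated 0F = false
designated _  = true

Designated : Value → Set
Designated x = designated x ≡ true

designated? : ∀ x → Dec (Designated x)
designated? x = designated x ≟ᵇ true

-- Truth must not be sent to `2F`: its negation is designated, whereas C14 needs a designated
-- conjunction to have an undesignated negation.
fromBool : Bool → Value
fromBool b = if b then 3F else 0F

infix  9 ∼ᵛ_
infixr 7 _∧ᵛ_
infixr 6 _∨ᵛ_
infixr 5 _→ᵛ_

∼ᵛ_ : Value → Value
∼ᵛ 0F = 1F
∼ᵛ 1F = 0F
∼ᵛ 2F = 3F
∼ᵛ 3F = 0F

_∨ᵛ_ _→ᵛ_ _∧ᵛ_ : Value → Value → Value
x ∨ᵛ y = if does (x ≤? y) then y else x
x →ᵛ y = fromBool (not (designated x) or designated y)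
x ∧ᵛ y = fromBool (designated x ∧ designated y)

eval : (ℕ → Value) → Formula → Value
eval ρ (var n)  = ρ n
eval ρ (∼ α)    = ∼ᵛ eval ρ α
eval ρ (α ∨ β)  = eval ρ α ∨ᵛ eval ρ β
eval ρ (α →d β) = eval ρ α →ᵛ eval ρ β
eval ρ (α ∧d β) = eval ρ α ∧ᵛ eval ρ β

-- Abstracting the values of subformulas leaves a closed `f`, so the finite check evaluates; on
-- success `True` becomes the unit type and the implicit argument is solved.
valid₁ : (f : Value → Value) {_ : True (all? λ x → designated? (f x))} →
         ∀ x → Designated (f x)
valid₁ f {t} = toWitness t

valid₂ : (f : Value → Value → Value)
         {_ : True (all? λ x → all? λ y → designated? (f x y))} →
         ∀ x y → Designated (f x y)
valid₂ f {t} = toWitness t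

valid₃ : (f : Value → Value → Value → Value)
         {_ : True (all? λ x → all? λ y → all? λ z → designated? (f x y z))} →
         ∀ x y z → Designated (f x y z)
valid₃ f {t} = toWitness t

axiom-designated : ∀ ρ {α} → Axiom α → Designated (eval ρ α)
axiom-designated ρ (C1 α β) = valid₂ (λ x y → x →ᵛ y →ᵛ x) (eval ρ α) (eval ρ β)
axiom-designated ρ (C2 α β γ) =
  valid₃ (λ x y z → (x →ᵛ y →ᵛ z) →ᵛ (x →ᵛ y) →ᵛ x →ᵛ z)
    (eval ρ α) (eval ρ β) (eval ρ γ)
axiom-designated ρ (C3 α β) = valid₂ (λ x y → x ∧ᵛ y →ᵛ x) (eval ρ α) (eval ρ β)
axiom-designated ρ (C4 α β) = valid₂ (λ x y → x ∧ᵛ y →ᵛ y) (eval ρ α) (eval ρ β)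
axiom-designated ρ (C5 α β) = valid₂ (λ x y → x →ᵛ y →ᵛ x ∧ᵛ y) (eval ρ α) (eval ρ β)
axiom-designated ρ (C6 α β) = valid₂ (λ x y → x →ᵛ x ∨ᵛ y) (eval ρ α) (eval ρ β)
axiom-designated ρ (C7 α β) = valid₂ (λ x y → y →ᵛ x ∨ᵛ y) (eval ρ α) (eval ρ β)
axiom-designated ρ (C8 α β γ) =
  valid₃ (λ x y z → (x →ᵛ z) →ᵛ (y →ᵛ z) →ᵛ x ∨ᵛ y →ᵛ z)
    (eval ρ α) (eval ρ β) (eval ρ γ)
axiom-designated ρ (C9 α β) = valid₂ (λ x y → x ∨ᵛ (x →ᵛ y)) (eval ρ α) (eval ρ β)
-- `∼ᵛ_` maps 0 and 2 to 1 and 3, so `x` and `∼ᵛ x` never both lie in {0 , 2}.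
axiom-designated ρ (C10 α) =
  valid₁ (λ x → ∼ᵛ (∼ᵛ x ∧ᵛ ∼ᵛ ∼ᵛ x ∧ᵛ ∼ᵛ (x ∨ᵛ ∼ᵛ x))) (eval ρ α)
axiom-designated ρ (C11 α β γ) =
  valid₃ (λ x y z → ∼ᵛ (∼ᵛ x ∧ᵛ ∼ᵛ y ∧ᵛ ∼ᵛ (x ∨ᵛ y))
                 →ᵛ ∼ᵛ (∼ᵛ x ∧ᵛ ∼ᵛ y ∧ᵛ ∼ᵛ z ∧ᵛ ∼ᵛ (x ∨ᵛ y ∨ᵛ z)))
    (eval ρ α) (eval ρ β) (eval ρ γ)
axiom-designated ρ (C12 α β γ) =
  valid₃ (λ x y z → ∼ᵛ (∼ᵛ x ∧ᵛ ∼ᵛ y ∧ᵛ ∼ᵛ z ∧ᵛ ∼ᵛ (x ∨ᵛ y ∨ᵛ z))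
                 →ᵛ ∼ᵛ (∼ᵛ x ∧ᵛ ∼ᵛ z ∧ᵛ ∼ᵛ y ∧ᵛ ∼ᵛ (x ∨ᵛ z ∨ᵛ y)))
    (eval ρ α) (eval ρ β) (eval ρ γ)
-- If `x` and `y` are 0, the premise puts `z` outside {0 , 2}, whence `∼ᵛ z` is 0.
axiom-designated ρ (C13 α β γ) =
  valid₃ (λ x y z → ∼ᵛ (∼ᵛ x ∧ᵛ ∼ᵛ y ∧ᵛ ∼ᵛ z ∧ᵛ ∼ᵛ (x ∨ᵛ y ∨ᵛ z))
                 →ᵛ x ∨ᵛ y ∨ᵛ ∼ᵛ z →ᵛ x ∨ᵛ y)
    (eval ρ α) (eval ρ β) (eval ρ γ)
axiom-designated ρ (C14 α β) =
  valid₂ (λ x y → ∼ᵛ (∼ᵛ x ∧ᵛ ∼ᵛ y) →ᵛ x ∨ᵛ y) (eval ρ α) (eval ρ β)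
axiom-designated ρ (C15 α β) =
  valid₂ (λ x y → x ∨ᵛ y ∨ᵛ ∼ᵛ y →ᵛ ∼ᵛ (∼ᵛ x ∧ᵛ ∼ᵛ (y ∨ᵛ ∼ᵛ y))) (eval ρ α) (eval ρ β)

→ᵛ-detachment : ∀ x y → Designated x → Designated (x →ᵛ y) → Designated y
→ᵛ-detachment = toWitness {a? = all? λ x → all? λ y →
  designated? x →-dec designated? (x →ᵛ y) →-dec designated? y} _

soundness : ∀ ρ {α} → ⊢ α → Designated (eval ρ α)
soundness ρ (ax a)   = axiom-designated ρ a
soundness ρ (mp p q) = →ᵛ-detachment _ _ (soundness ρ p) (soundness ρ q)

refuting : ℕ → Value
refuting zero    = 3F
refuting (suc _) = 2F

proposition2p5 : ∃₂ λ (α β : Formula) → ¬ (⊢ (∼ (∼ ∼ α ∨ β) →d ∼ (α ∨ β)))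
-- The antecedent evaluates to ∼ 2 = 3 and the consequent to ∼ 3 = 0, so the implication is 0 and
-- its designation reads `false ≡ true`.
proposition2p5 = var 0 , var 1 , λ p → contradiction (soundness refuting p) λ ()
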